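{- Let $V=(v_{ij})\in(\mathbb R\cup\{\infty\})^{d\times n}$ be a matrix none of whose columns is identically $\infty$. The union of the covector decompositions induced by the matrices $V(Z)$ on the strata $\mathbb{TP}_{\min}^{d-1}(Z)$, where $Z$ ranges over all proper subsets of $[d]$, yields a piecewise linear decomposition of the tropical projective space $\mathbb{TP}_{\min}^{d-1}$.
   Context: $\mathbb T_{\min}=\mathbb R\cup\{\infty\}$, and $\mathbf 1$ is the all-ones vector. The tropical projective space $\mathbb{TP}_{\min}^{d-1}$ is the quotient of $\mathbb T_{\min}^d\setminus\{(\infty,\dots,\infty)\}$ by $\mathbb R\mathbf 1$ (adding a real constant to all coordinates), with the quotient topology, where $\mathbb T_{\min}$ has the topology of a half-open interval. For a proper subset $Z\subsetneq[d]$ the stratum is $\mathbb{TP}_{\min}^{d-1}(Z)=\{p\in\mathbb{TP}_{\min}^{d-1} : p_i=\infty\text{ iff }i\in Z\}$, identified with $\mathbb R^{[d]\setminus Z}/\mathbb R\mathbf 1$. For $u\in\mathbb T_{\min}^d$ and $i$ with $u_i\neq\infty$ the sector is $S_i(u)=\{z\in\mathbb R^d : z_\ell-z_i\le u_\ell-u_i\text{ for all }\ell\text{ with }u_\ell\neq\infty\}$. The sectors of $u$ are the maximal cells of a polyhedral complex $\Delta(u)$ covering $\mathbb R^d$ (its cells are intersections of nonempty families of sectors of $u$). The covector decomposition $\mathcal T(V)$ of $\mathbb R^d$ is the common refinement of the complexes $\Delta(v^{(j)})$, where $v^{(j)}$ is the $j$th column of $V$; it induces a decomposition of $\mathbb R^d/\mathbb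 R\mathbf 1$. For a matrix with no columns it consists of the single cell $\mathbb R^d$. $V(Z)$ is the matrix obtained from $V$ by removing all columns $j$ for which there is an $i\in Z$ with $v_{ij}\ne\infty$, and then removing the rows with labels in $Z$. It has rows labeled by $[d]\setminus Z$, and its covector decomposition of $\mathbb R^{[d]\setminus Z}/\mathbb R\mathbf 1$ is a decomposition of the stratum $\mathbb{TP}_{\min}^{d-1}(Z)$. In particular $V(\emptyset)=V$. "Piecewise linear decomposition" means: the resulting finite family of cells (each being a polyhedron in its stratum) covers $\mathbb{TP}_{\min}^{d-1}$, the closure in $\mathbb{TP}_{\min}^{d-1}$ of each cell is a union of cells of the family, and the intersection of the closures of any two cells is a (possibly empty) union of cells of the family. -}

module Defs where

open import Algebra.Bundles using (CommutativeRing)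
open import Data.Bool.Base using (Bool; T)
open import Data.Fin.Base using (Fin)
open import Data.Fin.Subset using (Subset; _∈_; _∉_; _⊂_; ⊤)
open import Data.Fin.Subset.Properties using (_∈?_)
open import Data.Irrelevant using ([_])
open import Data.List.Base using (List)
open import Data.List.Relation.Unary.All using (All)
open import Data.List.Relation.Unary.Any using (Any)
open import Data.Nat.Base using (ℕ)
open import Data.Product.Base using (Σ; ∃; _×_; _,_; proj₁)
open import Data.Refinement using (Refinement-syntax; value; _,_)
open import Level using (0ℓ) renaming (suc to lsuc)
open import Relation.Binary.Core using (Rel)
import Relation.Binary.Construct.Add.Supremum.Equality as SupremumEquality
import Relation.Binary.Construct.Add.Supremum.Strict as SupremumStrict
import Relation.Binary.Construct.NonStrictToStrict as NonStrictToStrict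
open import Relation.Binary.PropositionalEquality using (_≡_; _≢_)
open import Relation.Binary.Structures using (IsDecTotalOrder)
open import Relation.Nullary.Construct.Add.Supremum using (_⁺; [_]; ⊤⁺)
open import Relation.Nullary.Decidable using (yes; no)
open import Relation.Nullary.Negation using (¬_)
open import Relation.Unary using (Pred; _≐_; _∩_; ⋂; ⋃)

-- The real numbers, axiomatised as a Dedekind-complete ordered field (unique
-- up to isomorphism in classical mathematics).  The order is decidable, as it
-- is for the classical real numbers.

record Reals : Set₁ where
  field
    commutativeRing : CommutativeRing 0ℓ 0ℓ
  open CommutativeRing commutativeRing public renaming (Carrier to ℝ)
  infix 4 _≤_
  field
    0≉1             : ¬ (0# ≈ 1#)
    inverse         : ∀ x → ¬ (x ≈ 0#) → ∃ λ y → x * y ≈ 1#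
    _≤_             : Rel ℝ 0ℓ
    isDecTotalOrder : IsDecTotalOrder _≈_ _≤_
    +-monoʳ-≤       : ∀ z {x y} → x ≤ y → z + x ≤ z + y
    *-nonneg        : ∀ {x y} → 0# ≤ x → 0# ≤ y → 0# ≤ x * y

  UpperBound : Pred ℝ 0ℓ → Pred ℝ 0ℓ
  UpperBound P b = ∀ {x} → P x → x ≤ b

  field
    complete : ∀ (P : Pred ℝ 0ℓ) → ∃ P → ∃ (UpperBound P) →
               ∃ λ s → UpperBound P s × (∀ {b} → UpperBound P b → s ≤ b)

module Tropical (reals : Reals) where

  open Reals reals
  open NonStrictToStrict _≈_ _≤_ using (_<_)
  open SupremumEquality _≈_ using (_≈⁺_)
  open SupremumStrict _<_ using (_<⁺_)

  -- 𝕋 is ℝ ∪ {∞}, with ∞ written ⊤⁺ and the inclusion of ℝ written [_].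

  𝕋 : Set
  𝕋 = ℝ ⁺

  shift : ℝ → 𝕋 → 𝕋
  shift c [ x ] = [ c + x ]
  shift c ⊤⁺    = ⊤⁺

  -- TP d consists of representatives of the points of the tropical projective
  -- space of dimension d - 1; two of them are the same point when they are
  -- related by _∼_.

  TP : ℕ → Set
  TP d = Σ (Fin d → 𝕋) λ p → ∃ λ i → p i ≢ ⊤⁺

  infix 4 _∼_
  _∼_ : ∀ {d} → Rel (Fin d → 𝕋) 0ℓ
  p ∼ q = ∃ λ c → ∀ i → shift c (p i) ≈⁺ q i

  -- The open intervals ⟨ a , b ⟩ and the half-open intervals ⟨ a ,∞] are a
  -- base of the topology of 𝕋.

  data Interval : Set where
    ⟨_,_⟩ : ℝ → ℝ → Interval
    ⟨_,∞] : ℝ → Interval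

  _∈ᴵ_ : 𝕋 → Interval → Set
  t ∈ᴵ ⟨ a , b ⟩ = [ a ] <⁺ t × t <⁺ [ b ]
  t ∈ᴵ ⟨ a ,∞]   = [ a ] <⁺ t

  -- Quotient topology: a set is open when it is a union of _∼_-classes and
  -- its preimage is open in the subspace topology of the product 𝕋ᵈ.

  record Open {d} (U : Pred (TP d) 0ℓ) : Set where
    field
      saturated    : ∀ {p q : TP d} → proj₁ p ∼ proj₁ q → U p → U q
      neighborhood : ∀ {p : TP d} → U p → ∃ λ (B : Fin d → Interval) →
                     (∀ i → proj₁ p i ∈ᴵ B i) ×
                     (∀ {q : TP d} → (∀ i → proj₁ q i ∈ᴵ B i) → U q)

  Closure : ∀ {d} → Pred (TP d) 0ℓ → Pred (TP d) (lsuc 0ℓ)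
  Closure A p = ∀ U → Open U → U p → ∃ λ q → U q × A q

  -- Below, subsets of ℝᴵ that are invariant under adding constants stand for
  -- subsets of the quotient of ℝᴵ by multiples of the all-ones vector.

  module _ {I : Set} where

    -- Only meaningful for u i ≢ ⊤⁺ (it is empty otherwise).

    Sector : (I → 𝕋) → I → Pred (I → ℝ) 0ℓ
    Sector u i z = ∃ λ a → u i ≡ [ a ] ×
                   (∀ ℓ {b} → u ℓ ≡ [ b ] → z ℓ - z i ≤ b - a)

    -- The cells of the complex Δ(u); A is the set of indices of the sectors
    -- that are intersected.

    Δ : (I → 𝕋) → Pred (Pred (I → ℝ) 0ℓ) 0ℓ
    Δ u C = ∃ λ (A : I → Bool) →
            (∃ λ i → T (A i)) ×
            (∀ i → T (A i) → u i ≢ ⊤⁺) ×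
            C ≐ (λ z → ∀ i → T (A i) → Sector u i z)

    -- The cells of the covector decomposition.  The empty set counts as a
    -- cell when an intersection of cells of the complexes Δ is empty.

    𝒯 : {J : Set} → (I → J → 𝕋) → Pred (Pred (I → ℝ) 0ℓ) (lsuc 0ℓ)
    𝒯 {J} V C = ∃ λ (F : J → Pred (I → ℝ) 0ℓ) →
                (∀ j → Δ (λ i → V i j) (F j)) × C ≐ ⋂ J F

    record LinearFunctional : Set where
      field
        ⟦_⟧    : (I → ℝ) → ℝ
        cong   : ∀ {x y} → (∀ i → x i ≈ y i) → ⟦_⟧ x ≈ ⟦_⟧ y
        +-homo : ∀ x y → ⟦_⟧ (λ i → x i + y i) ≈ ⟦_⟧ x + ⟦_⟧ y
        *-homo : ∀ c x → ⟦_⟧ (λ i → c * x i) ≈ c * ⟦_⟧ x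
        1-homo : ⟦_⟧ (λ _ → 1#) ≈ 0#

    open LinearFunctional public using (⟦_⟧)

    -- Solution sets of finitely many inequalities φ z ≤ b, where φ is a linear
    -- functional on the quotient of ℝᴵ by multiples of the all-ones vector.

    IsPolyhedron : Pred (Pred (I → ℝ) 0ℓ) 0ℓ
    IsPolyhedron Q = ∃ λ (φbs : List (LinearFunctional × ℝ)) →
                     Q ≐ (λ z → All (λ (φ , b) → ⟦ φ ⟧ z ≤ b) φbs)

  Row : ∀ {d} → Subset d → Set
  Row {d} Z = [ i ∈ Fin d ∣ i ∉ Z ]

  Column : ∀ {d n} → (Fin d → Fin n → 𝕋) → Subset d → Set
  Column {d} {n} V Z = [ j ∈ Fin n ∣ (∀ i → i ∈ Z → V i j ≡ ⊤⁺) ]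

  -- The matrix V(Z).

  _⦅_⦆ : ∀ {d n} (V : Fin d → Fin n → 𝕋) (Z : Subset d) →
         Row Z → Column V Z → 𝕋
  (V ⦅ Z ⦆) i j = V (value i) (value j)

  extend : ∀ {d} (Z : Subset d) → (Row Z → ℝ) → Fin d → 𝕋
  extend Z z i with i ∈? Z
  ... | yes _   = ⊤⁺
  ... | no  i∉Z = [ z (i , [ i∉Z ]) ]

  -- The subset of the stratum of Z corresponding to a subset of ℝ^([d] ∖ Z).

  inStratum : ∀ {d} (Z : Subset d) → Pred (Row Z → ℝ) 0ℓ → Pred (TP d) 0ℓ
  inStratum Z D (p , _) = ∃ λ z → D z × extend Z z ∼ p

  CovectorCells : ∀ {d n} → (Fin d → Fin n → 𝕋) →
                  Pred (Pred (TP d) 0ℓ) (lsuc 0ℓ)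
  CovectorCells V C = ∃ λ Z → Z ⊂ ⊤ × ∃ λ D →
                      𝒯 (V ⦅ Z ⦆) D × C ≐ inStratum Z D

  module _ {d} (𝒦 : Pred (Pred (TP d) 0ℓ) (lsuc 0ℓ)) where

    IsUnionOfCells : Pred (TP d) (lsuc 0ℓ) → Set₁
    IsUnionOfCells A = ∃ λ (K : Set) → ∃ λ (F : K → Pred (TP d) 0ℓ) →
                       (∀ k → 𝒦 (F k)) × A ≐ ⋃ K F

    record IsPiecewiseLinearDecomposition : Set₁ where
      field
        finite       : ∃ λ (Cs : List (Pred (TP d) 0ℓ)) →
                       ∀ {C} → 𝒦 C → Any (C ≐_) Cs
        polyhedral   : ∀ {C} → 𝒦 C → ∃ λ Z → Z ⊂ ⊤ × ∃ λ Q →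
                       IsPolyhedron Q × C ≐ inStratum Z Q
        covers       : ∀ p → ∃ λ C → 𝒦 C × C p
        closure      : ∀ {C} → 𝒦 C → IsUnionOfCells (Closure C)
        intersection : ∀ {C D} → 𝒦 C → 𝒦 D →
                       IsUnionOfCells (Closure C ∩ Closure D)

{-# OPTIONS --safe #-}

-- A covector cell in the stratum of Z is given by a choice G of a nonempty set
-- of finite entries in each column of V(Z): it consists of the p with
-- v i j + p ℓ ≤ v ℓ j + p i whenever (i , j) ∈ G.  The closure of a nonempty cell
-- is the set of all p with p i = ∞ on Z that satisfy these inequalities in 𝕋:
-- each inequality is a closed condition, and conversely, for a point q of the
-- cell, min(p , t + q) is a point of the cell that tends to p as t → ∞.  If
-- this closure meets the stratum of Z′ in a point p, then p ℓ = ∞ forces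
-- p i = ∞ in each inequality, so on that stratum only the inequalities of
-- columns of V(Z′) survive and they are again those of G; the intersection is
-- the cell of G at Z′.  Two closures are intersected by uniting the choices.

module Submission where

open import Data.Bool.Base using (Bool; true; false; T; _∨_)
open import Data.Bool.Properties using (T-∨; T?)
open import Data.Fin.Base as Fin using (Fin)
open import Data.Fin.Properties using (_≟_; all?)
open import Data.Fin.Subset using (Subset; _∈_; _∉_; _⊂_; _⊆_; ⊤)
open import Data.Fin.Subset.Properties using (_∈?_; ∈⊤; ⊆-antisym)
open import Data.Irrelevant using ([_])
open import Data.List.Base as List using (List; []; _∷_; _++_; allFin; cartesianProductWith)
import Data.List.Extrema as Extrema
open import Data.List.Membership.Propositional using (lose) renaming (_∈_ to _∈ᴸ_)
open import Data.List.Membership.Propositional.Properties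
  using (∈-allFin; ∈-cartesianProductWith⁺)
open import Data.List.Relation.Unary.All as All using (All; []; _∷_)
open import Data.List.Relation.Unary.All.Properties using (map⁻; ++⁺; ++⁻ˡ; ++⁻ʳ)
open import Data.List.Relation.Unary.Any using (Any; here; there)
open import Data.Nat.Base using (ℕ; zero; suc)
open import Data.Product.Base using (∃; _×_; _,_; proj₁; proj₂)
open import Data.Refinement using (Refinement-syntax; value; _,_)
open import Data.Sum.Base using (_⊎_; inj₁; inj₂; [_,_]′)
open import Data.Unit.Base using (tt) renaming (⊤ to ⊤₁)
open import Data.Vec.Base using (Vec; []; _∷_; tabulate; lookup)
open import Data.Vec.Properties using (lookup∘tabulate; lookup⇒[]=; []=⇒lookup)
open import Function.Base using (_∘_; id)
open import Function.Bundles using (Equivalence)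
open import Level using (0ℓ)
open import Relation.Binary.Bundles using (DecTotalOrder; TotalOrder)
import Relation.Binary.Construct.Add.Supremum.Equality as SupremumEquality
import Relation.Binary.Construct.Add.Supremum.NonStrict as SupremumNonStrict
import Relation.Binary.Construct.Add.Supremum.Strict as SupremumStrict
import Relation.Binary.Properties.DecTotalOrder as DecTotalOrderProperties
open import Relation.Binary.PropositionalEquality as ≡ using (_≡_; _≢_)
import Relation.Binary.Reasoning.PartialOrder as PartialOrderReasoning
open import Relation.Nullary.Construct.Add.Supremum using ([_]; ⊤⁺; []-injective)
open import Relation.Nullary.Decidable
  using (Dec; yes; no; does; isYes; recompute; toWitness; fromWitness; dec-true; ¬?; _→-dec_)
open import Relation.Nullary.Negation using (¬_; contradiction)
open import Relation.Unary using (Pred; _≐_; _∩_; ⋂) renaming (_⊆_ to _⊆₁_)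
open import Relation.Unary.Properties using (≐-sym; ≐-trans)
import Algebra.Properties.AbelianGroup as AbelianGroupProperties
import Algebra.Properties.CommutativeSemigroup as CommutativeSemigroupProperties
import Algebra.Properties.Ring as RingProperties
open import Defs

open Equivalence using (to; from)

-- Enumeration of vectors with entries in a list.

vectors : ∀ {A : Set} → List A → ∀ n → List (Vec A n)
vectors xs zero    = [] ∷ []
vectors xs (suc n) = cartesianProductWith _∷_ xs (vectors xs n)

∈-vectors : ∀ {A : Set} {xs : List A} → (∀ x → x ∈ᴸ xs) → ∀ {n} (v : Vec A n) → v ∈ᴸ vectors xs n
∈-vectors x∈xs []      = here ≡.refl
∈-vectors x∈xs (x ∷ v) = ∈-cartesianProductWith⁺ _∷_ (x∈xs x) (∈-vectors x∈xs v)

module Proof (reals : Reals) where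

  open Reals reals
  open Tropical reals
  open AbelianGroupProperties +-abelianGroup
    using (\\-leftDividesˡ; \\-leftDividesʳ; //-rightDividesˡ; //-rightDividesʳ; ⁻¹-∙-comm; ⁻¹-involutive)
  open RingProperties ring using (-‿distribˡ-*; x[y-z]≈xy-xz)
  open CommutativeSemigroupProperties +-commutativeSemigroup using (interchange; x∙yz≈y∙xz)

  decTotalOrder : DecTotalOrder _ _ _
  decTotalOrder = record { isDecTotalOrder = isDecTotalOrder }

  open DecTotalOrder decTotalOrder using (_≤?_; poset; totalOrder; isTotalOrder; total)
  open DecTotalOrderProperties decTotalOrder using (_<_; ≰⇒>; <⇒≱)
  open PartialOrderReasoning poset
  open Extrema totalOrder using (max; xs≤max)

  -- Arithmetic in the ordered field `ℝ`.

  +-cancelˡ-≤ : ∀ z {x y} → z + x ≤ z + y → x ≤ y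
  +-cancelˡ-≤ z {x} {y} z+x≤z+y = begin
    x              ≈⟨ \\-leftDividesʳ z x ⟨
    - z + (z + x)  ≤⟨ +-monoʳ-≤ (- z) z+x≤z+y ⟩
    - z + (z + y)  ≈⟨ \\-leftDividesʳ z y ⟩
    y              ∎

  +-monoˡ-≤ : ∀ z {x y} → x ≤ y → x + z ≤ y + z
  +-monoˡ-≤ z {x} {y} x≤y = begin
    x + z  ≈⟨ +-comm x z ⟩
    z + x  ≤⟨ +-monoʳ-≤ z x≤y ⟩
    z + y  ≈⟨ +-comm z y ⟩
    y + z  ∎

  +-monoʳ-< : ∀ z {x y} → x < y → z + x < z + y
  +-monoʳ-< z x<y = ≰⇒> λ z+y≤z+x → <⇒≱ x<y (+-cancelˡ-≤ z z+y≤z+x)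

  [x+y]+[z-y]≈x+z : ∀ x y z → (x + y) + (z - y) ≈ x + z
  [x+y]+[z-y]≈x+z x y z = begin-equality
    (x + y) + (z - y)  ≈⟨ interchange x y z (- y) ⟩
    (x + z) + (y - y)  ≈⟨ +-congˡ (-‿inverseʳ y) ⟩
    (x + z) + 0#       ≈⟨ +-identityʳ (x + z) ⟩
    x + z              ∎

  [x+y]+[z-x]≈z+y : ∀ x y z → (x + y) + (z - x) ≈ z + y
  [x+y]+[z-x]≈z+y x y z = begin-equality
    (x + y) + (z - x)  ≈⟨ +-congʳ (+-comm x y) ⟩
    (y + x) + (z - x)  ≈⟨ [x+y]+[z-y]≈x+z y x z ⟩
    y + z              ≈⟨ +-comm y z ⟩
    z + y              ∎

  -- Sectors are defined by differences, but only sums keep their meaning at ∞; together with its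
  -- converse `sum⇒difference-≤` this passes between the two forms.
  difference⇒sum-≤ : ∀ {a b x y} → x - y ≤ b - a → a + x ≤ b + y
  difference⇒sum-≤ {a} {b} {x} {y} h = begin
    a + x              ≈⟨ [x+y]+[z-y]≈x+z a y x ⟨
    (a + y) + (x - y)  ≤⟨ +-monoʳ-≤ (a + y) h ⟩
    (a + y) + (b - a)  ≈⟨ [x+y]+[z-x]≈z+y a y b ⟩
    b + y              ∎

  sum⇒difference-≤ : ∀ {a b x y} → a + x ≤ b + y → x - y ≤ b - a
  sum⇒difference-≤ {a} {b} {x} {y} h = +-cancelˡ-≤ (a + y) (begin
    (a + y) + (x - y)  ≈⟨ [x+y]+[z-y]≈x+z a y x ⟩
    a + x              ≤⟨ h ⟩
    b + y              ≈⟨ [x+y]+[z-x]≈z+y a y b ⟨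
    (a + y) + (b - a)  ∎)

  x≤0⇒0≤-x : ∀ {x} → x ≤ 0# → 0# ≤ - x
  x≤0⇒0≤-x {x} x≤0 = begin
    0#        ≈⟨ -‿inverseˡ x ⟨
    - x + x   ≤⟨ +-monoʳ-≤ (- x) x≤0 ⟩
    - x + 0#  ≈⟨ +-identityʳ (- x) ⟩
    - x       ∎

  0≤1 : 0# ≤ 1#
  0≤1 with total 0# 1#
  ... | inj₁ 0≤1 = 0≤1
  ... | inj₂ 1≤0 = begin
    0#             ≤⟨ *-nonneg (x≤0⇒0≤-x 1≤0) (x≤0⇒0≤-x 1≤0) ⟩
    - 1# * - 1#    ≈⟨ -‿distribˡ-* 1# (- 1#) ⟨
    - (1# * - 1#)  ≈⟨ -‿cong (*-identityˡ (- 1#)) ⟩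
    - - 1#         ≈⟨ ⁻¹-involutive 1# ⟩
    1#             ∎

  0<1 : 0# < 1#
  0<1 = 0≤1 , 0≉1

  x<1+x : ∀ x → x < 1# + x
  x<1+x x = begin-strict
    x        ≈⟨ +-identityʳ x ⟨
    x + 0#   <⟨ +-monoʳ-< x 0<1 ⟩
    x + 1#   ≈⟨ +-comm x 1# ⟩
    1# + x   ∎

  1+1≉0 : ¬ (1# + 1# ≈ 0#)
  1+1≉0 1+1≈0 = <⇒≱ 0<1 (begin
    1#       ≤⟨ proj₁ (x<1+x 1#) ⟩
    1# + 1#  ≈⟨ 1+1≈0 ⟩
    0#       ∎)

  half : ∀ x → ∃ λ y → y + y ≈ x
  half x = let h , 2h≈1 = inverse (1# + 1#) 1+1≉0 in h * x , (begin-equality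
    h * x + h * x          ≈⟨ distribʳ x h h ⟨
    (h + h) * x            ≈⟨ *-congʳ (+-cong (*-identityˡ h) (*-identityˡ h)) ⟨
    (1# * h + 1# * h) * x  ≈⟨ *-congʳ (distribʳ h 1# 1#) ⟨
    ((1# + 1#) * h) * x    ≈⟨ *-congʳ 2h≈1 ⟩
    1# * x                 ≈⟨ *-identityˡ x ⟩
    x                      ∎)

  -- The common value is the midpoint: `ε` is half of `y - x`, and it is positive because `ε ≤ 0`
  -- would give `y ≤ x`. Moving `x` up and `y` down by less than `ε` keeps them in order.
  halfway : ∀ {x y} → x < y → ∃ λ ε → 0# < ε × x + ε ≈ y - ε
  halfway {x} {y} x<y = ε , ≰⇒> (λ ε≤0 → <⇒≱ x<y (begin
      y            ≈⟨ x+2ε≈y ⟨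
      (x + ε) + ε  ≤⟨ +-monoʳ-≤ (x + ε) ε≤0 ⟩
      (x + ε) + 0# ≈⟨ +-identityʳ (x + ε) ⟩
      x + ε        ≤⟨ +-monoʳ-≤ x ε≤0 ⟩
      x + 0#       ≈⟨ +-identityʳ x ⟩
      x            ∎))
    , (begin-equality
      x + ε              ≈⟨ //-rightDividesʳ ε (x + ε) ⟨
      ((x + ε) + ε) - ε  ≈⟨ +-congʳ x+2ε≈y ⟩
      y - ε              ∎)
    where
    ε = proj₁ (half (y - x))

    x+2ε≈y : (x + ε) + ε ≈ y
    x+2ε≈y = begin-equality
      (x + ε) + ε  ≈⟨ +-assoc x ε ε ⟩
      x + (ε + ε)  ≈⟨ +-congˡ (proj₂ (half (y - x))) ⟩
      x + (y - x)  ≈⟨ +-comm x (y - x) ⟩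
      (y - x) + x  ≈⟨ //-rightDividesˡ x y ⟩
      y            ∎

  -- The order of `𝕋` and the addition of constants.

  open SupremumEquality _≈_ using (_≈⁺_; ⊤⁺≈⊤⁺; ≈⁺-refl; ≈⁺-sym; ≈⁺-trans; [_])
  open SupremumNonStrict _≤_ using (_≤⁺_; _≤⊤⁺; [_]; ≤⁺-dec; ≤⁺-isTotalOrder; [≤]-injective)
  open SupremumStrict _<_ using (_<⁺_; [_]; [_]<⊤⁺)

  totalOrder⁺ : TotalOrder _ _ _
  totalOrder⁺ = record { isTotalOrder = ≤⁺-isTotalOrder isTotalOrder }

  open TotalOrder totalOrder⁺ using ()
    renaming (refl to ≤⁺-refl; trans to ≤⁺-trans; total to ≤⁺-total)

  open Extrema totalOrder⁺ using (argmin; f[argmin]≤f[xs])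

  ≰⁺⇒>⁺ : ∀ {s t} → ¬ (s ≤⁺ t) → t <⁺ s
  ≰⁺⇒>⁺ {s}     {⊤⁺}    s≰t = contradiction (s ≤⊤⁺) s≰t
  ≰⁺⇒>⁺ {⊤⁺}    {[ y ]} s≰t = [ y ]<⊤⁺
  ≰⁺⇒>⁺ {[ x ]} {[ y ]} s≰t = [ ≰⇒> (s≰t ∘ [_]) ]

  <⁺⇒≱⁺ : ∀ {s t} → s <⁺ t → ¬ (t ≤⁺ s)
  <⁺⇒≱⁺ [ x<y ] [ y≤x ] = <⇒≱ x<y y≤x

  shift-mono-≤⁺ : ∀ c {s t} → s ≤⁺ t → shift c s ≤⁺ shift c t
  shift-mono-≤⁺ c [ x≤y ] = [ +-monoʳ-≤ c x≤y ]
  shift-mono-≤⁺ c (s ≤⊤⁺) = shift c s ≤⊤⁺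

  shift-≡⊤⁺ : ∀ c {t} → shift c t ≡ ⊤⁺ → t ≡ ⊤⁺
  shift-≡⊤⁺ c {⊤⁺} _ = ≡.refl

  -- Adding `c` to both coordinates adds it to both sides. Hence the inequalities of a cell do not
  -- depend on the representative of a projective point.
  shift-invariant-≤⁺ : ∀ c s t {a b s′ t′} → shift c s ≈⁺ s′ → shift c t ≈⁺ t′ →
                       shift a s ≤⁺ shift b t → shift a s′ ≤⁺ shift b t′
  shift-invariant-≤⁺ c s ⊤⁺ _ ⊤⁺≈⊤⁺ _ = _ ≤⊤⁺
  shift-invariant-≤⁺ c [ x ] [ y ] {a} {b} {[ x′ ]} {[ y′ ]} [ c+x≈x′ ] [ c+y≈y′ ] [ a+x≤b+y ] =
    [ begin
      a + x′       ≈⟨ +-congˡ c+x≈x′ ⟨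
      a + (c + x)  ≈⟨ x∙yz≈y∙xz a c x ⟩
      c + (a + x)  ≤⟨ +-monoʳ-≤ c a+x≤b+y ⟩
      c + (b + y)  ≈⟨ x∙yz≈y∙xz c b y ⟩
      b + (c + y)  ≈⟨ +-congˡ c+y≈y′ ⟩
      b + y′       ∎ ]

  shift-shift : ∀ c t → shift (- c) (shift c t) ≈⁺ t
  shift-shift c [ x ] = [ \\-leftDividesʳ c x ]
  shift-shift c ⊤⁺    = ⊤⁺≈⊤⁺

  shift-cong : ∀ c {s t} → s ≈⁺ t → shift c s ≈⁺ shift c t
  shift-cong c ⊤⁺≈⊤⁺   = ⊤⁺≈⊤⁺
  shift-cong c [ x≈y ] = [ +-congˡ x≈y ]

  ≈⁺-⊤⁺ : ∀ {s t} → s ≈⁺ t → s ≡ ⊤⁺ → t ≡ ⊤⁺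
  ≈⁺-⊤⁺ ⊤⁺≈⊤⁺ ≡.refl = ≡.refl

  -- The last component says which argument is attained; inequalities for a minimum are reduced to
  -- those for its arguments by this case distinction.
  min : ∀ s t → ∃ λ m → m ≤⁺ s × m ≤⁺ t × (m ≡ s ⊎ m ≡ t)
  min s t with ≤⁺-total s t
  ... | inj₁ s≤t = s , ≤⁺-refl , s≤t , inj₁ ≡.refl
  ... | inj₂ t≤s = t , t≤s , ≤⁺-refl , inj₂ ≡.refl

  infinite? : ∀ (t : 𝕋) → Dec (t ≡ ⊤⁺)
  infinite? [ x ] = no λ ()
  infinite? ⊤⁺    = yes ≡.refl

  finite-part : ∀ {t : 𝕋} → t ≢ ⊤⁺ → ∃ λ x → t ≡ [ x ]
  finite-part {[ x ]} _   = x , ≡.refl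
  finite-part {⊤⁺}    t≢⊤ = contradiction ≡.refl t≢⊤

  -- The value 0 at ⊤⁺ is never used.
  real : 𝕋 → ℝ
  real [ x ] = x
  real ⊤⁺    = 0#

  [real] : ∀ {t} → t ≢ ⊤⁺ → [ real t ] ≡ t
  [real] {[ x ]} _   = ≡.refl
  [real] {⊤⁺}    t≢⊤ = contradiction ≡.refl t≢⊤

  -- The difference that is minimized over the rows in `covers`. The value ∞ for an infinite second
  -- argument, where subtraction would suggest -∞, prevents rows with infinite coordinates from
  -- attaining a finite minimum.
  gap : 𝕋 → 𝕋 → 𝕋
  gap [ a ] [ x ] = [ a - x ]
  gap [ a ] ⊤⁺    = ⊤⁺
  gap ⊤⁺    _     = ⊤⁺

  gap-finite : ∀ {s t} → s ≢ ⊤⁺ → t ≢ ⊤⁺ → gap s t ≢ ⊤⁺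
  gap-finite {⊤⁺}           s≢⊤ _   _ = s≢⊤ ≡.refl
  gap-finite {[ _ ]} {⊤⁺} _   t≢⊤ _ = t≢⊤ ≡.refl

  gap-≤ : ∀ {a b s t} → s ≢ ⊤⁺ → t ≢ ⊤⁺ → gap [ a ] s ≤⁺ gap [ b ] t → shift a t ≤⁺ shift b s
  gap-≤ {s = ⊤⁺}                s≢⊤ _   _           = contradiction ≡.refl s≢⊤
  gap-≤ {s = [ x ]}     {⊤⁺}    _   t≢⊤ _           = contradiction ≡.refl t≢⊤
  gap-≤ {a} {b} {[ x ]} {[ y ]} _   _   [ a-x≤b-y ] = [ begin
    a + y  ≈⟨ +-comm a y ⟩
    y + a  ≤⟨ difference⇒sum-≤ a-x≤b-y ⟩
    b + x  ∎ ]

  [x]≢⊤⁺ : ∀ {t : 𝕋} {x} → t ≡ [ x ] → t ≢ ⊤⁺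
  [x]≢⊤⁺ ≡.refl ()

  ⊤⁺-maximal : ∀ {t} → ⊤⁺ ≤⁺ t → t ≡ ⊤⁺
  ⊤⁺-maximal (_ ≤⊤⁺) = ≡.refl

  -- Neighborhoods in `𝕋`.

  lower : Interval → ℝ
  lower ⟨ a , b ⟩ = a
  lower ⟨ a ,∞]   = a

  -- An upper end, if there is one, is inherited from `s`. For a minimum with a point of the
  -- neighborhood only the lower ends remain to be checked.
  ∈ᴵ-downward : ∀ B {s t} → s ∈ᴵ B → [ lower B ] <⁺ t → t ≤⁺ s → t ∈ᴵ B
  ∈ᴵ-downward ⟨ a , b ⟩ (_ , s<b) a<t t≤s = a<t , ≰⁺⇒>⁺ λ b≤t → <⁺⇒≱⁺ s<b (≤⁺-trans b≤t t≤s)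
  ∈ᴵ-downward ⟨ a ,∞]   _         a<t _   = a<t

  box : ℝ → ℝ → 𝕋 → Interval
  box ε N [ x ] = ⟨ x - ε , x + ε ⟩
  box ε N ⊤⁺    = ⟨ N ,∞]

  ∈-box : ∀ {ε N} → 0# < ε → ∀ t → t ∈ᴵ box ε N t
  ∈-box {ε} 0<ε [ x ] = [ x-ε<x ] , [ x<x+ε ]
    where
    x<x+ε : x < x + ε
    x<x+ε = begin-strict x ≈⟨ +-identityʳ x ⟨ x + 0# <⟨ +-monoʳ-< x 0<ε ⟩ x + ε ∎

    x-ε<x : x - ε < x
    x-ε<x = begin-strict
      x - ε          ≈⟨ +-identityʳ (x - ε) ⟨
      (x - ε) + 0#   <⟨ +-monoʳ-< (x - ε) 0<ε ⟩
      (x - ε) + ε    ≈⟨ //-rightDividesˡ ε x ⟩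
      x              ∎
  ∈-box {N = N} _ ⊤⁺ = [ N ]<⊤⁺

  -- Two real coordinates are kept apart by the midpoint of the two sides; if `t` is infinite, a
  -- large threshold `N` does it. For this reason the complement of each inequality of a cell is
  -- open.
  separation : ∀ {a b s t} → shift b s <⁺ shift a t →
               ∃ λ ε → 0# < ε × ∃ λ N → ∀ {s′ t′} → s′ ∈ᴵ box ε N s → t′ ∈ᴵ box ε N t →
               shift b s′ <⁺ shift a t′
  separation {a} {b} {[ x ]} {[ y ]} [ b+x<a+y ] =
    let ε , 0<ε , b+x+ε≈a+y-ε = halfway b+x<a+y in
    ε , 0<ε , 0# , λ where
      (_ , [_] {x′} x′<x+ε) ([_] {l = y′} y-ε<y′ , _) → [ begin-strict
        b + x′       <⟨ +-monoʳ-< b x′<x+ε ⟩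
        b + (x + ε)  ≈⟨ +-assoc b x ε ⟨
        (b + x) + ε  ≈⟨ b+x+ε≈a+y-ε ⟩
        (a + y) - ε  ≈⟨ +-assoc a y (- ε) ⟩
        a + (y - ε)  <⟨ +-monoʳ-< a y-ε<y′ ⟩
        a + y′       ∎ ]
      (_ , [_] {x′} x′<x+ε) ([ _ ]<⊤⁺ , _) → [ b + x′ ]<⊤⁺
  separation {a} {b} {[ x ]} {⊤⁺} _ =
    -- With radius 1 the smaller side stays below `b + (x + 1#)`; the threshold is the coordinate at
    -- which the other side reaches this bound.
    1# , 0<1 , - a + (b + (x + 1#)) , λ where
      (_ , [_] {x′} x′<x+1) ([_] {l = y′} N<y′) → [ begin-strict
        b + x′                       <⟨ +-monoʳ-< b x′<x+1 ⟩
        b + (x + 1#)                 ≈⟨ \\-leftDividesˡ a _ ⟨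
        a + (- a + (b + (x + 1#)))   <⟨ +-monoʳ-< a N<y′ ⟩
        a + y′                       ∎ ]
      (_ , [_] {x′} x′<x+1) [ _ ]<⊤⁺ → [ b + x′ ]<⊤⁺

  -- Each finite coordinate of `q` demands a sufficiently large `t`, an infinite one is above every
  -- bound, and finitely many demands have a maximum.
  shift-above : ∀ {m} (a : Fin m → ℝ) (q : Fin m → 𝕋) → ∃ λ t → ∀ i → [ a i ] <⁺ shift t (q i)
  shift-above {m} a q = t , λ i → beyond (q i) (All.lookup needed≤t (∈-allFin i))
    where
    needed : ℝ → 𝕋 → ℝ
    -- The summand 1 makes the final inequality strict.
    needed a [ x ] = (1# + a) - x
    needed a ⊤⁺    = 0#

    t : ℝ
    t = max 0# (List.map (λ i → needed (a i) (q i)) (allFin m))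

    needed≤t : All (λ i → needed (a i) (q i) ≤ t) (allFin m)
    needed≤t = map⁻ (xs≤max 0# (List.map (λ i → needed (a i) (q i)) (allFin m)))

    beyond : ∀ {a} s → needed a s ≤ t → [ a ] <⁺ shift t s
    beyond {a} [ x ] h = [ begin-strict
      a                    <⟨ x<1+x a ⟩
      1# + a               ≈⟨ //-rightDividesˡ x (1# + a) ⟨
      ((1# + a) - x) + x   ≤⟨ +-monoˡ-≤ x h ⟩
      t + x                ∎ ]
    beyond {a} ⊤⁺ _ = [ a ]<⊤⁺

  -- Open sets and strata of the projective space.

  module _ {d : ℕ} where

    ∼-sym : ∀ {p q : Fin d → 𝕋} → p ∼ q → q ∼ p
    ∼-sym {p} {q} (c , cp≈q) = - c , λ i →
      ≈⁺-trans trans (shift-cong (- c) (≈⁺-sym sym (cp≈q i))) (shift-shift c (p i))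

    ∼-⊤⁺ : ∀ {p q : Fin d → 𝕋} → p ∼ q → ∀ {i} → p i ≡ ⊤⁺ → q i ≡ ⊤⁺
    ∼-⊤⁺ {p} (c , cp≈q) {i} pi≡⊤ = ≈⁺-⊤⁺ (cp≈q i) (≡.cong (shift c) pi≡⊤)

    -- Testing a closure point against this set yields a point of the cell, so a cell whose closure
    -- has a point is nonempty.
    open-everything : Open {d} (λ _ → ⊤₁)
    open-everything = record
      { saturated    = λ _ _ → tt
      ; neighborhood = λ {p} _ → (λ i → box 1# 0# (proj₁ p i)) , (λ i → ∈-box 0<1 (proj₁ p i)) , λ _ → tt
      }

    -- The complementary condition is closed, so coordinates that are infinite on a cell remain
    -- infinite on its closure.
    open-finite : ∀ i → Open {d} (λ p → proj₁ p i ≢ ⊤⁺)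
    open-finite i = record
      { saturated    = λ p∼q pi≢⊤ qi≡⊤ → pi≢⊤ (∼-⊤⁺ (∼-sym p∼q) qi≡⊤)
      ; neighborhood = λ {p} pi≢⊤ → (λ j → box 1# 0# (proj₁ p j)) , (λ j → ∈-box 0<1 (proj₁ p j)) ,
                       λ {q} q∈box → bounded (proj₁ p i) pi≢⊤ (q∈box i)
      }
      where
      bounded : ∀ s {t} → s ≢ ⊤⁺ → t ∈ᴵ box 1# 0# s → t ≢ ⊤⁺
      bounded ⊤⁺    s≢⊤ _        = contradiction ≡.refl s≢⊤
      bounded [ x ] _   (_ , ()) ≡.refl

    open-≰ : ∀ a b ℓ i → Open {d} (λ p → ¬ (shift a (proj₁ p ℓ) ≤⁺ shift b (proj₁ p i)))
    open-≰ a b ℓ i = record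
      { saturated    = λ {_} {q} p∼q p≰ q≤ → let c , cq≈p = ∼-sym p∼q in
                       p≰ (shift-invariant-≤⁺ c (proj₁ q ℓ) (proj₁ q i) (cq≈p ℓ) (cq≈p i) q≤)
      ; neighborhood = λ {p} p≰ → let ε , 0<ε , N , separated = separation (≰⁺⇒>⁺ p≰) in
                       (λ j → box ε N (proj₁ p j)) , (λ j → ∈-box 0<ε (proj₁ p j)) ,
                       λ {q} q∈box → <⁺⇒≱⁺ (separated (q∈box i) (q∈box ℓ))
      }

    ∞-set : (Fin d → 𝕋) → Subset d
    ∞-set p = tabulate (λ i → does (infinite? (p i)))

    ∞-set⁺ : ∀ p {i} → p i ≡ ⊤⁺ → i ∈ ∞-set p
    ∞-set⁺ p {i} pi≡⊤ = lookup⇒[]= i (∞-set p)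
      (≡.trans (lookup∘tabulate _ i) (dec-true (infinite? (p i)) pi≡⊤))

    ∞-set⁻ : ∀ p {i} → i ∈ ∞-set p → p i ≡ ⊤⁺
    ∞-set⁻ p {i} i∈ with infinite? (p i) in eq
    ... | yes pi≡⊤ = pi≡⊤
    ... | no  pi≢⊤ = contradiction
      (≡.trans (≡.sym ([]=⇒lookup i∈)) (≡.trans (lookup∘tabulate _ i) (≡.cong does eq))) λ ()

    ∞-set-⊂ : (p : TP d) → ∞-set (proj₁ p) ⊂ ⊤
    ∞-set-⊂ (p , i , pi≢⊤) = (λ _ → ∈⊤) , i , ∈⊤ , pi≢⊤ ∘ ∞-set⁻ p

    -- The proof stored in a row is irrelevant; decidability of membership recovers one that can be
    -- used.
    ∉-row : ∀ {Z : Subset d} (i : Row Z) → value i ∉ Z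
    ∉-row {Z} (i , [ i∉Z ]) = recompute (¬? (i ∈? Z)) i∉Z

    extend-∈ : ∀ {Z : Subset d} {z i} → i ∈ Z → extend Z z i ≡ ⊤⁺
    extend-∈ {Z} {z} {i} i∈Z with i ∈? Z
    ... | yes _   = ≡.refl
    ... | no  i∉Z = contradiction i∈Z i∉Z

    extend-∉ : ∀ {Z : Subset d} {z} (i : Row Z) → extend Z z (value i) ≡ [ z i ]
    extend-∉ {Z} {z} row@(i , _) with i ∈? Z
    ... | yes i∈Z = contradiction i∈Z (∉-row row)
    ... | no  _   = ≡.refl

    inStratum-mono : ∀ {Z : Subset d} {D E} → D ⊆₁ E → inStratum Z D ⊆₁ inStratum Z E
    inStratum-mono D⊆E (z , z∈D , z∼p) = z , D⊆E z∈D , z∼p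

    Closure-mono : ∀ {C D : Pred (TP d) 0ℓ} → C ⊆₁ D → Closure C ⊆₁ Closure D
    Closure-mono C⊆D cl U U-open Up = let q , Uq , Cq = cl U U-open Up in q , Uq , C⊆D Cq

  -- Polyhedra.

  module _ {I : Set} where

    difference : I → I → LinearFunctional {I}
    difference ℓ i = record
      { ⟦_⟧    = λ z → z ℓ - z i
      ; cong   = λ x≈y → +-cong (x≈y ℓ) (-‿cong (x≈y i))
      ; +-homo = λ x y → begin-equality
          (x ℓ + y ℓ) - (x i + y i)      ≈⟨ +-congˡ (⁻¹-∙-comm (x i) (y i)) ⟨
          (x ℓ + y ℓ) + (- x i - y i)    ≈⟨ interchange (x ℓ) (y ℓ) (- x i) (- y i) ⟩
          (x ℓ - x i) + (y ℓ - y i)      ∎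
      ; *-homo = λ c x → sym (x[y-z]≈xy-xz c (x ℓ) (x i))
      ; 1-homo = -‿inverseʳ 1#
      }

    IsPolyhedron-resp-≐ : ∀ {P Q : Pred (I → ℝ) 0ℓ} → P ≐ Q → IsPolyhedron P → IsPolyhedron Q
    IsPolyhedron-resp-≐ P≐Q (φbs , P≐φbs) = φbs , ≐-trans (≐-sym P≐Q) P≐φbs

    isPolyhedron-halfspace : ∀ ℓ i b → IsPolyhedron (λ (z : I → ℝ) → z ℓ - z i ≤ b)
    isPolyhedron-halfspace ℓ i b = (difference ℓ i , b) ∷ [] , (_∷ []) , λ where (h ∷ []) → h

    isPolyhedron-U : ∀ {Q : Pred (I → ℝ) 0ℓ} → (∀ z → Q z) → IsPolyhedron Q
    isPolyhedron-U Qz = [] , (λ _ → []) , λ {z} _ → Qz z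

    isPolyhedron-∀ : ∀ m {Q : Fin m → Pred (I → ℝ) 0ℓ} →
                     (∀ k → IsPolyhedron (Q k)) → IsPolyhedron (⋂ (Fin m) Q)
    isPolyhedron-∀ zero    _ = isPolyhedron-U λ _ ()
    isPolyhedron-∀ (suc m) {Q} polyhedra
      with φbs , to , from ← polyhedra Fin.zero
         | φbs′ , to′ , from′ ← isPolyhedron-∀ m (polyhedra ∘ Fin.suc) =
      φbs ++ φbs′ ,
      (λ q → ++⁺ (to (q Fin.zero)) (to′ (q ∘ Fin.suc))) ,
      λ all → λ where
        Fin.zero    → from (++⁻ˡ φbs all)
        (Fin.suc k) → from′ (++⁻ʳ φbs all) k

    -- Once the premise is decided, the set is the polyhedron of one proof or the whole space;
    -- `const` lets that one proof stand for all others.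
    isPolyhedron-→ : ∀ {A : Set} → Dec A → {Q : A → Pred (I → ℝ) 0ℓ} →
                     (∀ a → IsPolyhedron (Q a)) → (∀ {a a′} → Q a ⊆₁ Q a′) →
                     IsPolyhedron (λ z → ∀ a → Q a z)
    isPolyhedron-→ (yes a) polyhedra const =
      IsPolyhedron-resp-≐ ((λ q a′ → const q) , λ q → q a) (polyhedra a)
    isPolyhedron-→ (no ¬a) _ _ = isPolyhedron-U λ _ a → contradiction a ¬a

    isPolyhedron-refinement : ∀ {m} {A : Fin m → Set} → (∀ k → Dec (A k)) →
                              {Q : [ k ∈ Fin m ∣ A k ] → Pred (I → ℝ) 0ℓ} →
                              (∀ k → IsPolyhedron (Q k)) → IsPolyhedron (⋂ [ k ∈ Fin m ∣ A k ] Q)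
    isPolyhedron-refinement {m} A? polyhedra =
      IsPolyhedron-resp-≐
        ((λ { q (k , [ a ]) → q k (recompute (A? k) a) }) , λ q k a → q (k , [ a ]))
        (isPolyhedron-∀ m λ k → isPolyhedron-→ (A? k) (λ a → polyhedra (k , [ a ])) id)

  -- Patterns, their cells, and the closures of these cells.

  module Cells {d n : ℕ} (V : Fin d → Fin n → 𝕋) where

    -- A pattern marks entries of the whole matrix `V`, so that one pattern can be read on every
    -- stratum; `Z` only determines which columns are consulted.
    Pattern : Set
    Pattern = Fin d → Fin n → Bool

    HasColumn : Subset d → Fin n → Set
    HasColumn Z j = ∀ i → i ∈ Z → V i j ≡ ⊤⁺

    hasColumn? : ∀ Z j → Dec (HasColumn Z j)
    hasColumn? Z j = all? λ i → i ∈? Z →-dec infinite? (V i j)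

    -- A finite entry of a column of `V ⦅ Z ⦆` automatically lies in a row outside `Z`, so these are
    -- choices of sectors for `V ⦅ Z ⦆`.
    Admissible : Subset d → Pattern → Set
    Admissible Z G = ∀ {j} → HasColumn Z j →
                     (∃ λ i → T (G i j)) × (∀ {i} → T (G i j) → V i j ≢ ⊤⁺)

    -- z ℓ - z i ≤ v ℓ j - v i j, with the terms moved so that it makes sense
    -- for coordinates in 𝕋.
    Inequalities : Subset d → Pattern → Pred (Fin d → 𝕋) 0ℓ
    Inequalities Z G p = ∀ {j} → HasColumn Z j → ∀ {i} → T (G i j) →
                         ∀ {ℓ a b} → V i j ≡ [ a ] → V ℓ j ≡ [ b ] →
                         shift a (p ℓ) ≤⁺ shift b (p i)

    Cell : Subset d → Pattern → Pred (TP d) 0ℓ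
    Cell Z G (p , _) = ∞-set p ≡ Z × Inequalities Z G p

    -- A point of the cell is required because the inequalities of an empty cell can still have
    -- solutions with further infinite coordinates, while its closure is empty.
    ClosedCell : Subset d → Pattern → Pred (TP d) 0ℓ
    ClosedCell Z G (p , _) = ∃ (Cell Z G) × Z ⊆ ∞-set p × Inequalities Z G p

    -- If `p` violated a condition, it would lie in an open set that misses the cell; decidability
    -- turns this refutation into a proof of the condition.
    closure⇒closedCell : ∀ {Z G} → Closure (Cell Z G) ⊆₁ ClosedCell Z G
    closure⇒closedCell {Z} {G} {p , _} cl =
      (let q , _ , q∈cell = cl _ open-everything tt in q , q∈cell) ,
      Z⊆ , ineq
      where
      Z⊆ : Z ⊆ ∞-set p
      Z⊆ {i} i∈Z with infinite? (p i)
      ... | yes pi≡⊤ = ∞-set⁺ p pi≡⊤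
      ... | no  pi≢⊤ with cl _ (open-finite i) pi≢⊤
      ...   | (q , _) , qi≢⊤ , ≡.refl , _ = contradiction (∞-set⁻ q i∈Z) qi≢⊤

      ineq : Inequalities Z G p
      ineq j∈ {i} Gij {ℓ} {a} {b} vij vℓj with ≤⁺-dec _≤?_ (shift a (p ℓ)) (shift b (p i))
      ... | yes p≤ = p≤
      ... | no  p≰ with cl _ (open-≰ a b ℓ i) p≰
      ...   | _ , q≰ , _ , q∈ = contradiction (q∈ j∈ Gij vij vℓj) q≰

    closedCell⇒closure : ∀ {Z G} → ClosedCell Z G ⊆₁ Closure (Cell Z G)
    closedCell⇒closure {Z} {G} {p , _} (((q , i₀ , qi₀≢⊤) , ≡.refl , q-ineq) , Z⊆ , p-ineq) U U-open Up
      with Open.neighborhood U-open Up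
    -- For this `t` the point `t + q` is above all lower ends of `B`, and so is its minimum `w` with
    -- `p`; as `w` is at most `p`, it lies in the neighborhood.
    ... | B , p∈B , B⊆U with shift-above (lower ∘ B) q
    ...   | t , B<t+q = (w , i₀ , qi₀≢⊤ ∘ w⇒q) , B⊆U w∈B ,
                        -- `w` is infinite exactly where both `p` and `q` are, and this is where `q`
                        -- is, since `p` is infinite on all of `Z`.
                        ⊆-antisym (λ i∈ → ∞-set⁺ q (w⇒q (∞-set⁻ w i∈)))
                                  (λ i∈ → ∞-set⁺ w (q⇒w (∞-set⁻ q i∈) (∞-set⁻ p (Z⊆ i∈)))) ,
                        λ j∈ Gij vij vℓj → w-ineq (p-ineq j∈ Gij vij vℓj) (q-ineq j∈ Gij vij vℓj)
      where
      w : Fin d → 𝕋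
      w i = proj₁ (min (p i) (shift t (q i)))

      w≤p : ∀ i → w i ≤⁺ p i
      w≤p i = proj₁ (proj₂ (min (p i) (shift t (q i))))

      w≤t+q : ∀ i → w i ≤⁺ shift t (q i)
      w≤t+q i = proj₁ (proj₂ (proj₂ (min (p i) (shift t (q i)))))

      w-sel : ∀ i → w i ≡ p i ⊎ w i ≡ shift t (q i)
      w-sel i = proj₂ (proj₂ (proj₂ (min (p i) (shift t (q i)))))

      w⇒q : ∀ {i} → w i ≡ ⊤⁺ → q i ≡ ⊤⁺
      w⇒q {i} wi≡⊤ = shift-≡⊤⁺ t (⊤⁺-maximal (≡.subst (_≤⁺ _) wi≡⊤ (w≤t+q i)))

      q⇒w : ∀ {i} → q i ≡ ⊤⁺ → p i ≡ ⊤⁺ → w i ≡ ⊤⁺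
      q⇒w {i} qi≡⊤ pi≡⊤ with w-sel i
      ... | inj₁ w≡p   = ≡.trans w≡p pi≡⊤
      ... | inj₂ w≡t+q = ≡.trans w≡t+q (≡.cong (shift t) qi≡⊤)

      lower<w : ∀ i → [ lower (B i) ] <⁺ w i
      lower<w i with w-sel i
      ... | inj₁ w≡p   = ≡.subst (_ <⁺_) (≡.sym w≡p) (lower< (B i) (p∈B i))
        where
        lower< : ∀ I {s} → s ∈ᴵ I → [ lower I ] <⁺ s
        lower< ⟨ _ , _ ⟩ = proj₁
        lower< ⟨ _ ,∞]   a<s = a<s
      ... | inj₂ w≡t+q = ≡.subst (_ <⁺_) (≡.sym w≡t+q) (B<t+q i)

      w∈B : ∀ i → w i ∈ᴵ B i
      w∈B i = ∈ᴵ-downward (B i) (p∈B i) (lower<w i) (w≤p i)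

      -- Whichever of `p` and `t + q` attains the minimum at `i` also bounds `w` at `ℓ`, and its own
      -- inequality connects the two.
      w-ineq : ∀ {i ℓ a b} → shift a (p ℓ) ≤⁺ shift b (p i) → shift a (q ℓ) ≤⁺ shift b (q i) →
               shift a (w ℓ) ≤⁺ shift b (w i)
      w-ineq {i} {ℓ} {a} {b} p≤ q≤ with w-sel i
      ... | inj₁ w≡p = ≡.subst (λ s → _ ≤⁺ shift b s) (≡.sym w≡p)
        (≤⁺-trans (shift-mono-≤⁺ a (w≤p ℓ)) p≤)
      ... | inj₂ w≡t+q = ≡.subst (λ s → _ ≤⁺ shift b s) (≡.sym w≡t+q)
        (≤⁺-trans (shift-mono-≤⁺ a (w≤t+q ℓ))
                  (shift-invariant-≤⁺ t (q ℓ) (q i) (≈⁺-refl refl) (≈⁺-refl refl) q≤))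

    -- Closed cells on the strata, and unions of patterns.

    hasColumn-mono : ∀ {Z Z′ j} → Z ⊆ Z′ → HasColumn Z′ j → HasColumn Z j
    hasColumn-mono Z⊆Z′ j∈ i i∈Z = j∈ i (Z⊆Z′ i∈Z)

    -- Since `Z` is contained in the infinite set of `p`, passing to the stratum of `p` only drops
    -- columns, and the pattern can be kept.
    closedCell⇒cell : ∀ {Z G} {p : TP d} → ClosedCell Z G p → Cell (∞-set (proj₁ p)) G p
    closedCell⇒cell (_ , Z⊆ , ineq) = ≡.refl , λ j∈ → ineq (hasColumn-mono Z⊆ j∈)

    -- In the inequalities of a column that is not in V(Z′), where Z′ is the set
    -- of infinite coordinates of p, necessarily i ∈ Z′, so they hold on the
    -- whole stratum of Z′.
    cell⊆closedCell : ∀ {Z G} {p : TP d} → ClosedCell Z G p → Cell (∞-set (proj₁ p)) G ⊆₁ ClosedCell Z G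
    cell⊆closedCell {Z} {G} {p , _} (nonempty , Z⊆ , p-ineq) {q , _} (∞q≡∞p , q-ineq) =
      nonempty , (λ i∈Z → ≡.subst (_ ∈_) (≡.sym ∞q≡∞p) (Z⊆ i∈Z)) , ineq
      where
      p⇒q : ∀ {i} → p i ≡ ⊤⁺ → q i ≡ ⊤⁺
      p⇒q {i} pi≡⊤ = ∞-set⁻ q (≡.subst (i ∈_) (≡.sym ∞q≡∞p) (∞-set⁺ p pi≡⊤))

      ineq : Inequalities Z G q
      ineq {j} j∈ {i} Gij {ℓ} {a} {b} vij vℓj with infinite? (p i)
      ... | yes pi≡⊤ = ≡.subst (λ s → shift a (q ℓ) ≤⁺ shift b s) (≡.sym (p⇒q pi≡⊤)) (_ ≤⊤⁺)
      ... | no  pi≢⊤ = q-ineq j∈′ Gij vij vℓj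
        where
        j∈′ : HasColumn (∞-set p) j
        j∈′ k k∈ with infinite? (V k j)
        ... | yes vkj≡⊤ = vkj≡⊤
        ... | no  vkj≢⊤ = let b , vkj = finite-part vkj≢⊤ in contradiction
          (shift-≡⊤⁺ b (⊤⁺-maximal
            (≡.subst (λ s → shift _ s ≤⁺ shift b (p i)) (∞-set⁻ p k∈) (p-ineq j∈ Gij vij vkj))))
          pi≢⊤

    Admissible-mono : ∀ {Z Z′ G} → Z ⊆ Z′ → Admissible Z G → Admissible Z′ G
    Admissible-mono Z⊆Z′ adm = adm ∘ hasColumn-mono Z⊆Z′

    infixr 6 _∪ᴾ_
    _∪ᴾ_ : Pattern → Pattern → Pattern
    (G ∪ᴾ H) i j = G i j ∨ H i j

    Admissible-∪ : ∀ {Z G H} → Admissible Z G → Admissible Z H → Admissible Z (G ∪ᴾ H)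
    Admissible-∪ admG admH j∈ =
      (let i , Gij = proj₁ (admG j∈) in i , from T-∨ (inj₁ Gij)) ,
      λ GHij → [ proj₂ (admG j∈) , proj₂ (admH j∈) ]′ (to T-∨ GHij)

    Cell-∪ : ∀ {Z G H} → Cell Z (G ∪ᴾ H) ≐ Cell Z G ∩ Cell Z H
    Cell-∪ =
      (λ (∞p≡Z , ineq) → (∞p≡Z , λ j∈ Gij → ineq j∈ (from T-∨ (inj₁ Gij))) ,
                         (∞p≡Z , λ j∈ Hij → ineq j∈ (from T-∨ (inj₂ Hij)))) ,
      λ ((∞p≡Z , ineqG) , (_ , ineqH)) →
        ∞p≡Z , λ j∈ GHij → [ ineqG j∈ , ineqH j∈ ]′ (to T-∨ GHij)

    -- Patterns and the cells of the covector decomposition.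

    CellInStratum : ∀ Z → Pattern → Pred (Row Z → ℝ) 0ℓ
    CellInStratum Z G z = (j : Column V Z) (i : Row Z) → T (G (value i) (value j)) →
                          Sector (λ k → (V ⦅ Z ⦆) k j) i z

    hasColumn : ∀ {Z} (j : Column V Z) → HasColumn Z (value j)
    hasColumn {Z} (j , [ j∈ ]) = recompute (hasColumn? Z j) j∈

    finite⇒∉ : ∀ {Z j} → HasColumn Z j → ∀ {i} → V i j ≢ ⊤⁺ → i ∉ Z
    finite⇒∉ j∈ vij≢⊤ i∈Z = vij≢⊤ (j∈ _ i∈Z)

    finiteRow : ∀ {Z j} → HasColumn Z j → ∀ {i x} → V i j ≡ [ x ] → Row Z
    finiteRow j∈ {i} vij = i , [ finite⇒∉ j∈ ([x]≢⊤⁺ vij) ]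

    -- Off `Z` all coordinates are real, and there the inequalities in `𝕋` are the sector
    -- inequalities with their terms moved.
    cell≐inStratum : ∀ {Z G} → Admissible Z G → Cell Z G ≐ inStratum Z (CellInStratum Z G)
    cell≐inStratum {Z} {G} adm = (λ {p} → cell⇒ {p}) , λ {p} → cell⇐ {p}
      where
      cell⇒ : Cell Z G ⊆₁ inStratum Z (CellInStratum Z G)
      cell⇒ {p , _} (≡.refl , ineq) = z , z∈ , 0# , extend∼p
        where
        z : Row Z → ℝ
        z i = real (p (value i))

        [z] : ∀ (i : Row Z) → [ z i ] ≡ p (value i)
        [z] i = [real] (∉-row i ∘ ∞-set⁺ p)

        z∈ : CellInStratum Z G z
        z∈ j i Gij =
          let a , vij = finite-part (proj₂ (adm (hasColumn j)) Gij) in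
          a , vij , λ ℓ {b} vℓj → sum⇒difference-≤ ([≤]-injective
            (≡.subst₂ (λ s t → shift a s ≤⁺ shift b t) (≡.sym ([z] ℓ)) (≡.sym ([z] i))
              (ineq (hasColumn j) Gij vij vℓj)))

        0+p≈p : ∀ {s t} → s ≡ t → shift 0# s ≈⁺ t
        0+p≈p {⊤⁺}    ≡.refl = ⊤⁺≈⊤⁺
        0+p≈p {[ x ]} ≡.refl = [ +-identityˡ x ]

        extend∼p : ∀ i → shift 0# (extend Z z i) ≈⁺ p i
        extend∼p i with i ∈? Z
        ... | yes i∈Z = ≡.subst (_ ≈⁺_) (≡.sym (∞-set⁻ p i∈Z)) ⊤⁺≈⊤⁺
        ... | no  i∉Z = 0+p≈p ([z] (i , [ i∉Z ]))

      cell⇐ : inStratum Z (CellInStratum Z G) ⊆₁ Cell Z G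
      cell⇐ {p , _} (z , z∈ , ext∼p@(c , c+ext≈p)) = ⊆-antisym ∞p⊆Z Z⊆∞p , ineq
        where
        Z⊆∞p : Z ⊆ ∞-set p
        Z⊆∞p i∈Z = ∞-set⁺ p (∼-⊤⁺ ext∼p (extend-∈ i∈Z))

        ∞p⊆Z : ∞-set p ⊆ Z
        ∞p⊆Z {i} i∈ with i ∈? Z
        ... | yes i∈Z = i∈Z
        ... | no  i∉Z = contradiction (∼-⊤⁺ (∼-sym ext∼p) (∞-set⁻ p i∈)) ([x]≢⊤⁺ (extend-∉ (i , [ i∉Z ])))

        ineq : Inequalities Z G p
        ineq {j} j∈ {i} Gij {ℓ} {a} {b} vij vℓj
          with z∈ (j , [ j∈ ]) (finiteRow j∈ vij) Gij
        -- `Sector` brings its own real value of `V i j`, which has to be identified with `a`.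
        ... | a′ , vij′ , z≤ with ≡.trans (≡.sym vij) vij′
        ...   | ≡.refl = shift-invariant-≤⁺ c (extend Z z ℓ) (extend Z z i) (c+ext≈p ℓ) (c+ext≈p i)
          (≡.subst₂ (λ s t → shift a s ≤⁺ shift b t)
            (≡.sym (extend-∉ (finiteRow j∈ vℓj)))
            (≡.sym (extend-∉ (finiteRow j∈ vij)))
            [ difference⇒sum-≤ (z≤ (finiteRow j∈ vℓj) vℓj) ])

    covectorCell : ∀ {Z G} → Z ⊂ ⊤ → Admissible Z G → CovectorCells V (Cell Z G)
    covectorCell {Z} {G} Z⊂⊤ adm =
      Z , Z⊂⊤ , CellInStratum Z G ,
      -- `CellInStratum` quantifies over columns first, so it is definitionally an intersection of
      -- cells of the complexes `Δ` and identities suffice.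
      ((λ j z → ∀ i → T (G (value i) (value j)) → Sector (λ k → (V ⦅ Z ⦆) k j) i z) ,
       (λ j → (λ i → G (value i) (value j)) , nonempty j , (λ i → proj₂ (adm (hasColumn j))) , id , id) ,
       id , id) ,
      cell≐inStratum adm
      where
      nonempty : ∀ (j : Column V Z) → ∃ λ (i : Row Z) → T (G (value i) (value j))
      nonempty j = let i , Gij = proj₁ (adm (hasColumn j)) in
        (i , [ finite⇒∉ (hasColumn j) (proj₂ (adm (hasColumn j)) Gij) ]) , Gij

    -- The choice is extended by `false` to the entries outside `V ⦅ Z ⦆`. Irrelevance of the
    -- membership proofs ensures that those found by the deciders index the same entries.
    patternOf : ∀ Z → (Column V Z → Row Z → Bool) → Pattern
    patternOf Z A i j with hasColumn? Z j | i ∈? Z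
    ... | yes j∈ | no i∉Z = A (j , [ j∈ ]) (i , [ i∉Z ])
    ... | yes _  | yes _  = false
    ... | no _   | _      = false

    patternOf⁺ : ∀ {Z A} (j : Column V Z) (i : Row Z) → T (A j i) → T (patternOf Z A (value i) (value j))
    patternOf⁺ {Z} col@(j , _) row@(i , _) Aji with hasColumn? Z j | i ∈? Z
    ... | yes _ | no _    = Aji
    ... | yes _ | yes i∈Z = contradiction i∈Z (∉-row row)
    ... | no j∉ | _       = contradiction (hasColumn col) j∉

    patternOf⁻ : ∀ {Z A} (j : Column V Z) (i : Row Z) → T (patternOf Z A (value i) (value j)) → T (A j i)
    patternOf⁻ {Z} (j , _) (i , _) Gij with hasColumn? Z j | i ∈? Z
    ... | yes _ | no _ = Gij

    patternOf-row : ∀ {Z A i j} → T (patternOf Z A i j) → i ∉ Z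
    patternOf-row {Z} {A} {i} {j} Gij with hasColumn? Z j | i ∈? Z
    ... | yes _ | no i∉Z = i∉Z

    -- The index sets that come with the cells of the complexes `Δ` assemble to a pattern, which
    -- reduces statements about arbitrary cells to patterns.
    covectorCell⁻ : ∀ {C} → CovectorCells V C →
                    ∃ λ Z → Z ⊂ ⊤ × ∃ λ G → Admissible Z G × C ≐ Cell Z G
    covectorCell⁻ {C} (Z , Z⊂⊤ , D , (F , ΔF , D⊆⋂F , ⋂F⊆D) , C⊆ , ⊆C) =
      Z , Z⊂⊤ , G , adm ,
      (λ {p} Cp → proj₂ (cell≐inStratum adm) {p} (inStratum-mono D⊆ {p} (C⊆ Cp))) ,
      (λ {p} p∈ → ⊆C (inStratum-mono ⊆D {p} (proj₁ (cell≐inStratum adm) {p} p∈)))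
      where
      A : Column V Z → Row Z → Bool
      A j = proj₁ (ΔF j)

      G : Pattern
      G = patternOf Z A

      adm : Admissible Z G
      -- The equation is kept because `A`, and with it `G`, refers to `ΔF` itself and not to the
      -- matched components.
      adm {j} j∈ with ΔF (j , [ j∈ ]) in eq
      ... | A′ , (i , A′i) , A′-finite , _ =
        (value i , patternOf⁺ (j , [ j∈ ]) i (≡.subst (λ (A , _) → T (A i)) (≡.sym eq) A′i)) ,
        λ {k} Gkj → A′-finite (k , [ patternOf-row Gkj ])
          (≡.subst (λ (A , _) → T (A (k , [ patternOf-row Gkj ]))) eq
            (patternOf⁻ (j , [ j∈ ]) (k , [ patternOf-row Gkj ]) Gkj))

      D⊆ : D ⊆₁ CellInStratum Z G
      D⊆ z∈D j i Gij = let _ , _ , _ , F⊆ , _ = ΔF j in F⊆ (D⊆⋂F z∈D j) i (patternOf⁻ j i Gij)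

      ⊆D : CellInStratum Z G ⊆₁ D
      ⊆D z∈ = ⋂F⊆D λ j → let _ , _ , _ , _ , ⊆F = ΔF j in ⊆F λ i Aji → z∈ j i (patternOf⁺ j i Aji)

    -- Polyhedrality of the cells.

    isPolyhedron-sector : ∀ {Z : Subset d} (u : Row Z → 𝕋) {i a} → u i ≡ [ a ] → IsPolyhedron (Sector u i)
    isPolyhedron-sector {Z} u {i} {a} ui =
      IsPolyhedron-resp-≐
        ((λ z≤ → a , ui , z≤) ,
         -- The existential value in `Sector` is determined by `u i`, so the bounds are those for
         -- the fixed `a`.
         λ { (a′ , ui′ , z≤) → ≡.subst (λ a → ∀ ℓ {b} → u ℓ ≡ [ b ] → _ ≤ b - a) ([]-injective (≡.trans (≡.sym ui′) ui)) z≤ })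
        (isPolyhedron-refinement (λ ℓ → ¬? (ℓ ∈? Z)) λ ℓ → bound ℓ (u ℓ))
      where
      bound : ∀ ℓ t → IsPolyhedron (λ z → ∀ {b} → t ≡ [ b ] → z ℓ - z i ≤ b - a)
      bound ℓ ⊤⁺    = isPolyhedron-U λ _ ()
      bound ℓ [ b ] = IsPolyhedron-resp-≐ ((λ { z≤ ≡.refl → z≤ }) , λ z≤ → z≤ ≡.refl)
        (isPolyhedron-halfspace ℓ i _)

    isPolyhedron-cell : ∀ {Z G} → Admissible Z G → IsPolyhedron (CellInStratum Z G)
    isPolyhedron-cell {Z} {G} adm =
      isPolyhedron-refinement (hasColumn? Z) λ j →
      isPolyhedron-refinement (λ i → ¬? (i ∈? Z)) λ i →
      isPolyhedron-→ (T? (G (value i) (value j)))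
        (λ Gij → isPolyhedron-sector _ (proj₂ (finite-part (proj₂ (adm (hasColumn j)) Gij)))) id

    -- The properties of the decomposition.

    closure∩closure : ∀ {C D} → CovectorCells V C → CovectorCells V D →
                      IsUnionOfCells (CovectorCells V) (Closure C ∩ Closure D)
    closure∩closure {C} {D} C-cell D-cell
      with Z , _ , G , admG , C⊆ , ⊆C ← covectorCell⁻ C-cell
         | W , _ , H , admH , D⊆ , ⊆D ← covectorCell⁻ D-cell =
      -- The union is indexed by the points of the intersection, each contributing the cell of the
      -- united pattern on its stratum. `ClosedCell` in place of `Closure` keeps the index type in
      -- `Set`.
      (∃ λ p → ClosedCell Z G p × ClosedCell W H p) ,
      (λ (p , _) → Cell (∞-set (proj₁ p)) (G ∪ᴾ H)) ,
      (λ { (p , (_ , Z⊆ , _) , (_ , W⊆ , _)) →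
        covectorCell (∞-set-⊂ p) (Admissible-∪ (Admissible-mono Z⊆ admG) (Admissible-mono W⊆ admH)) }) ,
      (λ {p} (clC , clD) →
        let p∈G = closure⇒closedCell {x = p} (Closure-mono C⊆ clC)
            p∈H = closure⇒closedCell {x = p} (Closure-mono D⊆ clD)
        in (p , p∈G , p∈H) , proj₂ Cell-∪ {p} (closedCell⇒cell {p = p} p∈G , closedCell⇒cell {p = p} p∈H)) ,
      λ { {q} ((p , p∈G , p∈H) , q∈) →
        let q∈G , q∈H = proj₁ Cell-∪ {q} q∈ in
        Closure-mono ⊆C (closedCell⇒closure (cell⊆closedCell {p = p} p∈G {q} q∈G)) ,
        Closure-mono ⊆D (closedCell⇒closure (cell⊆closedCell {p = p} p∈H {q} q∈H)) }

    isUnionOfCells-closure : ∀ {C} → CovectorCells V C → IsUnionOfCells (CovectorCells V) (Closure C)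
    isUnionOfCells-closure C-cell with K , F , F-cells , to , from ← closure∩closure C-cell C-cell =
      K , F , F-cells , (λ cl → to (cl , cl)) , λ p∈ → proj₁ (from p∈)

    -- Patterns are listed as Boolean matrices, since vectors with equal entries are propositionally
    -- equal without function extensionality. The list may contain sets that are no cells; `finite`
    -- asks only that every cell occur up to `≐`.
    cells : List (Pred (TP d) 0ℓ)
    cells = cartesianProductWith (λ Z M → Cell Z (λ i j → lookup (lookup M i) j))
              (vectors (false ∷ true ∷ []) d) (vectors (vectors (false ∷ true ∷ []) n) d)

    cells-complete : ∀ {C} → CovectorCells V C → Any (C ≐_) cells
    cells-complete {C} C-cell with Z , _ , G , _ , C⊆ , ⊆C ← covectorCell⁻ C-cell =
      lose (∈-cartesianProductWith⁺ _ (∈-vectors ∈-bools Z) (∈-vectors (∈-vectors ∈-bools) M))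
        ((λ Cp → let ∞p≡Z , ineq = C⊆ Cp in ∞p≡Z , λ j∈ Mij → ineq j∈ (≡.subst T (M≡G _ _) Mij)) ,
         λ (∞p≡Z , ineq) → ⊆C (∞p≡Z , λ j∈ Gij → ineq j∈ (≡.subst T (≡.sym (M≡G _ _)) Gij)))
      where
      M : Vec (Vec Bool n) d
      M = tabulate (λ i → tabulate (G i))

      M≡G : ∀ i j → lookup (lookup M i) j ≡ G i j
      M≡G i j = ≡.trans (≡.cong (λ r → lookup r j) (lookup∘tabulate _ i)) (lookup∘tabulate (G i) j)

      ∈-bools : ∀ b → b ∈ᴸ false ∷ true ∷ []
      ∈-bools false = here ≡.refl
      ∈-bools true  = there (here ≡.refl)

    -- p lies in the sector of column j at each i where v i j - p i is minimal.
    covers : (∀ j → ∃ λ i → V i j ≢ ⊤⁺) → ∀ p → ∃ λ C → CovectorCells V C × C p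
    covers V-finite (p , i₀ , pi₀≢⊤) = Cell Z G , covectorCell (∞-set-⊂ (p , i₀ , pi₀≢⊤)) adm , ≡.refl , ineq
      where
      Z : Subset d
      Z = ∞-set p

      minimizer : Fin n → Fin d
      minimizer j = argmin (λ i → gap (V i j) (p i)) i₀ (allFin d)

      minimal : ∀ j i → gap (V (minimizer j) j) (p (minimizer j)) ≤⁺ gap (V i j) (p i)
      minimal j i = All.lookup (f[argmin]≤f[xs] i₀ (allFin d)) (∈-allFin i)

      G : Pattern
      G i j = isYes (i ≟ minimizer j)

      Gij⇒≡ : ∀ {i j} → T (G i j) → i ≡ minimizer j
      Gij⇒≡ {i} {j} = toWitness {a? = i ≟ minimizer j}

      -- A finite entry of column `j` lies in a row where `p` is finite, because the column survives
      -- in `V ⦅ Z ⦆`. Its gap is finite, hence so is the minimal gap, which excludes an infinite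
      -- entry at the minimizer.
      minimizer-finite : ∀ {j} → HasColumn Z j → V (minimizer j) j ≢ ⊤⁺
      minimizer-finite {j} j∈ vmj≡⊤ with i , vij≢⊤ ← V-finite j =
        gap-finite vij≢⊤ (finite⇒∉ j∈ vij≢⊤ ∘ ∞-set⁺ p)
          (⊤⁺-maximal (≡.subst (λ v → gap v (p (minimizer j)) ≤⁺ gap (V i j) (p i)) vmj≡⊤ (minimal j i)))

      adm : Admissible Z G
      adm {j} j∈ = (minimizer j , fromWitness {a? = minimizer j ≟ minimizer j} ≡.refl) ,
                   λ Gij → ≡.subst (λ i → V i j ≢ ⊤⁺) (≡.sym (Gij⇒≡ Gij)) (minimizer-finite j∈)

      ineq : Inequalities Z G p
      ineq {j} j∈ Gij {ℓ} vij vℓj with ≡.refl ← Gij⇒≡ Gij =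
        gap-≤ (finite⇒∉ j∈ ([x]≢⊤⁺ vij) ∘ ∞-set⁺ p) (finite⇒∉ j∈ ([x]≢⊤⁺ vℓj) ∘ ∞-set⁺ p)
          (≡.subst₂ (λ u v → gap u (p (minimizer j)) ≤⁺ gap v (p ℓ)) vij vℓj (minimal j ℓ))

theorem50 : (reals : Reals) → let open Tropical reals in
    (d n : ℕ) (V : Fin d → Fin n → 𝕋) →
    (∀ j → ∃ λ i → V i j ≢ ⊤⁺) →
    IsPiecewiseLinearDecomposition (CovectorCells V)
theorem50 reals d n V V-finite = record
  { finite       = cells , cells-complete
  ; polyhedral   = λ C-cell → let Z , Z⊂⊤ , G , adm , C≐ = covectorCell⁻ C-cell in
                   Z , Z⊂⊤ , CellInStratum Z G , isPolyhedron-cell adm , ≐-trans C≐ (cell≐inStratum adm)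
  ; covers       = covers V-finite
  ; closure      = isUnionOfCells-closure
  ; intersection = closure∩closure
  }
  where open Proof.Cells reals V
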